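{- Let $G$ be a simple graph. Let $k_3$ be the number of subsets of $V(G)$ of cardinality three that induce a connected subgraph of $G$. Let $S_{3,2}$ be the number of connected subgraphs of $G$ with order three and size two, and let $S_{3,3}$ be the number of connected subgraphs of $G$ with order three and size three. Then $$k_3 = S_{3,2}-2S_{3,3}.$$
   Context: Graphs are finite and simple. The order of a graph is its number of vertices and the size is its number of edges. Subgraphs counted by $S_{3,2}$ and $S_{3,3}$ are not required to be induced; a subgraph is determined by its vertex set and edge set. -}

module Defs where

open import Data.Fin.Base using (Fin; _<_)
open import Data.Fin.Properties using (_≟_; _<?_; all?; any?)
open import Data.Fin.Subset using (Subset; inside; outside; _∈_; ∣_∣; Nonempty)
open import Data.Fin.Subset.Properties using (_∈?_; nonempty?)
open import Data.List.Base
  using (List; []; _∷_; map; _++_; filter; length; lookup; allFin; cartesianProduct)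
open import Data.List.Membership.Propositional using () renaming (_∈_ to _∈ˡ_)
open import Data.List.Membership.Propositional.Properties using (∈-allFin)
open import Data.List.Relation.Unary.Any using (here; there)
open import Data.Nat.Base using (ℕ; zero; suc)
import Data.Nat.Properties as ℕ
open import Data.Product.Base using (∃; _×_; _,_; proj₁; proj₂; uncurry)
open import Data.Product.Properties using (≡-dec)
open import Data.Sum.Base using (_⊎_; inj₁; inj₂)
open import Data.Vec.Base as Vec using (tabulate)
open import Level using (0ℓ)
open import Relation.Binary.Core using (Rel)
open import Relation.Binary.Definitions using (Decidable; Symmetric; Irreflexive)
open import Relation.Binary.Construct.Closure.ReflexiveTransitive using (Star; ε; _◅_; _◅◅_)
open import Relation.Binary.PropositionalEquality using (_≡_; refl)
open import Relation.Nullary.Decidable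
  using (does; map′; _×-dec_; _⊎-dec_; _→-dec_)
open import Relation.Unary using () renaming (Decidable to Decidable₁)

private
  variable
    n : ℕ

-- Star is decidable on Fin n.  Via ws u v says that v can be reached from u
-- by a path whose interior vertices lie in ws (the Floyd–Warshall recursion).

module _ {E : Rel (Fin n) 0ℓ} (E? : Decidable E) where

  private
    Via : List (Fin n) → Rel (Fin n) 0ℓ
    Via []       u v = u ≡ v ⊎ E u v
    Via (w ∷ ws) u v = Via ws u v ⊎ (Via ws u w × Via ws w v)

    via? : ∀ ws → Decidable (Via ws)
    via? []       u v = (u ≟ v) ⊎-dec E? u v
    via? (w ∷ ws) u v = via? ws u v ⊎-dec (via? ws u w ×-dec via? ws w v)

    sound : ∀ ws {u v} → Via ws u v → Star E u v
    sound []       (inj₁ refl)    = ε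
    sound []       (inj₂ e)       = e ◅ ε
    sound (w ∷ ws) (inj₁ p)       = sound ws p
    sound (w ∷ ws) (inj₂ (p , q)) = sound ws p ◅◅ sound ws q

    via-refl : ∀ ws {u} → Via ws u u
    via-refl []       = inj₁ refl
    via-refl (w ∷ ws) = inj₁ (via-refl ws)

    via-edge : ∀ ws {u v} → E u v → Via ws u v
    via-edge []       e = inj₂ e
    via-edge (w ∷ ws) e = inj₁ (via-edge ws e)

    via-trans : ∀ {w ws u v} → w ∈ˡ ws → Via ws u w → Via ws w v → Via ws u v
    via-trans (here refl) p q = inj₂ (to p , from q)
      where
      to : ∀ {w ws u} → Via (w ∷ ws) u w → Via ws u w
      to (inj₁ p)       = p
      to (inj₂ (p , _)) = p
      from : ∀ {w ws v} → Via (w ∷ ws) w v → Via ws w v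
      from (inj₁ q)       = q
      from (inj₂ (_ , q)) = q
    via-trans (there i) (inj₁ p)       (inj₁ q)       = inj₁ (via-trans i p q)
    via-trans (there i) (inj₁ p)       (inj₂ (q , r)) = inj₂ (via-trans i p q , r)
    via-trans (there i) (inj₂ (p , q)) (inj₁ r)       = inj₂ (p , via-trans i q r)
    via-trans (there i) (inj₂ (p , _)) (inj₂ (_ , s)) = inj₂ (p , s)

    complete : ∀ {u v} → Star E u v → Via (allFin n) u v
    complete ε        = via-refl (allFin n)
    complete (_◅_ {j = w} e es) =
      via-trans (∈-allFin w) (via-edge (allFin n) e) (complete es)

  star? : Decidable (Star E)
  star? u v = map′ (sound (allFin n)) complete (via? (allFin n) u v)

record SimpleGraph (n : ℕ) : Set₁ where
  field
    Adj         : Rel (Fin n) 0ℓ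
    adj?        : Decidable Adj
    symmetric   : Symmetric Adj
    irreflexive : Irreflexive _≡_ Adj

  -- Each undirected edge is listed once, with its smaller endpoint first.
  edges : List (Fin n × Fin n)
  edges = filter (uncurry λ u v → u <? v ×-dec adj? u v)
                 (cartesianProduct (allFin n) (allFin n))

  Edge : Set
  Edge = Fin (length edges)

  src tgt : Edge → Fin n
  src e = proj₁ (lookup edges e)
  tgt e = proj₂ (lookup edges e)

-- A set of vertices of G together with a set of edges of G; it is a subgraph
-- when IsSubgraph holds.

SubgraphData : SimpleGraph n → Set
SubgraphData {n} G = Subset n × Subset (length (SimpleGraph.edges G))

module _ (G : SimpleGraph n) where
  open SimpleGraph G

  IsSubgraph : SubgraphData G → Set
  IsSubgraph (W , F) = ∀ e → e ∈ F → src e ∈ W × tgt e ∈ W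

  isSubgraph? : Decidable₁ IsSubgraph
  isSubgraph? (W , F) =
    all? λ e → (e ∈? F) →-dec ((src e ∈? W) ×-dec (tgt e ∈? W))

  order size : SubgraphData G → ℕ
  order (W , F) = ∣ W ∣
  size  (W , F) = ∣ F ∣

  Joined : SubgraphData G → Rel (Fin n) 0ℓ
  Joined (W , F) u v =
    ∃ λ e → e ∈ F × (lookup edges e ≡ (u , v) ⊎ lookup edges e ≡ (v , u))

  joined? : ∀ H → Decidable (Joined H)
  joined? (W , F) u v = any? λ e →
    (e ∈? F) ×-dec ((lookup edges e ≟₂ (u , v)) ⊎-dec (lookup edges e ≟₂ (v , u)))
    where _≟₂_ = ≡-dec _≟_ _≟_

  -- For a subgraph, a walk along its edges that starts in its vertex set stays
  -- there, so walks need not mention the vertex set.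
  Connected : SubgraphData G → Set
  Connected H@(W , F) =
    Nonempty W × (∀ u → u ∈ W → ∀ v → v ∈ W → Star (Joined H) u v)

  connected? : Decidable₁ Connected
  connected? H@(W , F) = nonempty? W ×-dec
    (all? λ u → (u ∈? W) →-dec all? λ v → (v ∈? W) →-dec star? (joined? H) u v)

  induced : Subset n → SubgraphData G
  induced W = W , tabulate λ e → does ((src e ∈? W) ×-dec (tgt e ∈? W))

allSubsets : ∀ n → List (Subset n)
allSubsets zero    = Vec.[] ∷ []
allSubsets (suc n) =
  map (outside Vec.∷_) (allSubsets n) ++ map (inside Vec.∷_) (allSubsets n)

module _ (G : SimpleGraph n) where
  open SimpleGraph G

  k₃ : ℕ
  k₃ = length (filter (λ W → (∣ W ∣ ℕ.≟ 3) ×-dec connected? G (induced G W))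
                      (allSubsets n))

  S : ℕ → ℕ → ℕ
  S i j = length (filter
    (λ H → isSubgraph? G H ×-dec connected? G H
             ×-dec (order G H ℕ.≟ i) ×-dec (size G H ℕ.≟ j))
    (cartesianProduct (allSubsets n) (allSubsets (length edges))))

{-# OPTIONS --safe #-}

-- On a fixed set W of three vertices a subgraph is a subset F of the set I of
-- edges inside W, and ∣I∣ ≤ 3.  Such a subgraph is connected iff ∣F∣ ≥ 2: two
-- sides of a triangle share a vertex, and conversely each of the three vertices
-- lies on an edge of F while an edge has only two ends.  So W contributes 1
-- to k₃ iff ∣I∣ ≥ 2, and ∣I∣ C j to S 3 j for j = 2, 3; the identity reduces
-- to [∣I∣ ≥ 2] + 2 (∣I∣ C 3) = ∣I∣ C 2 for ∣I∣ ≤ 3.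

module Submission where

open import Defs
open import Algebra.Bundles using (AbelianGroup)
open import Algebra.Properties.Group using (//-rightDividesʳ)
open import Data.Bool.Properties using (T-≡)
open import Data.Fin.Base using (Fin; zero; suc; _<_; combine)
open import Data.Fin.Properties
  using (<-cmp; <-irrefl; <-asym; <⇒≢; injective⇒≤; combine-injective; _<?_)
open import Data.Fin.Subset using (Subset; inside; outside; _∈_; _⊆_; ∣_∣)
open import Data.Fin.Subset.Properties
  using (_∈?_; _⊆?_; out⊆; in⊆in; drop-∷-⊆)
open import Data.Integer.Base using (+_; _-_; _*_)
import Data.Integer.Properties as ℤ
open import Data.List.Base
  using (List; []; _∷_; _++_; map; filter; length; lookup; allFin; cartesianProduct)
open import Data.List.Membership.Propositional.Properties using (∈-lookup; ∈-filter⁻)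
open import Data.List.Properties
  using (length-++; filter-++; filter-≐; filter-none; filter-accept; filter-reject)
open import Data.List.Relation.Unary.All as All using (universal)
open import Data.List.Relation.Unary.AllPairs using (_∷_)
open import Data.List.Relation.Unary.Unique.Propositional using (Unique)
open import Data.List.Relation.Unary.Unique.Propositional.Properties
  using (cartesianProduct⁺; allFin⁺; filter⁺)
open import Data.Nat.Base as ℕ using (ℕ; zero; suc; _≤_; z≤n; s≤s)
open import Data.Nat.Combinatorics using (_C_; nCk+nC[k+1]≡[n+1]C[k+1])
import Data.Nat.Properties as ℕ
open import Data.Nat.Tactic.RingSolver using (solve-∀)
open import Data.Product.Base as Product using (∃; ∃₂; _×_; _,_; proj₁; proj₂; uncurry)
open import Data.Sum.Base using (inj₁; inj₂; swap)
open import Data.Vec.Base using ([]; _∷_; here; there)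
open import Data.Vec.Properties using ([]=⇒lookup; lookup⇒[]=; lookup∘tabulate)
open import Function.Base using (_∘_; id; flip)
open import Function.Bundles using (module Equivalence)
open import Function.Definitions using (Injective)
open import Level using (0ℓ)
open import Relation.Binary.Core using (Rel)
open import Relation.Binary.Definitions using (Symmetric; tri<; tri≈; tri>)
open import Relation.Binary.Construct.Closure.ReflexiveTransitive
  using (Star; ε; _◅_; _◅◅_; gmap; reverse)
open import Relation.Binary.PropositionalEquality
open import Relation.Nullary using (¬_; Dec; yes; no; contradiction)
open import Relation.Nullary.Decidable using (dec-true; toWitness; isYes≗does; _×-dec_)
open import Relation.Unary using (Pred; _≐_) renaming (Decidable to Decidable₁)

private
  variable
    A B : Set
    n : ℕ

-- Lists without repetition and counting by decidable predicates.

lookup-injective : {xs : List A} → Unique xs → Injective _≡_ _≡_ (lookup xs)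
lookup-injective (_ ∷ _) {zero} {zero} _ = refl
lookup-injective (x∉ ∷ _) {zero} {suc j} eq =
  contradiction eq (All.lookup x∉ (∈-lookup j))
lookup-injective (x∉ ∷ _) {suc i} {zero} eq =
  contradiction (sym eq) (All.lookup x∉ (∈-lookup i))
lookup-injective (_ ∷ u) {suc i} {suc j} eq = cong suc (lookup-injective u eq)

count : {P : Pred A 0ℓ} → Decidable₁ P → List A → ℕ
count P? = length ∘ filter P?

module _ {P : Pred A 0ℓ} (P? : Decidable₁ P) where

  count-++ : ∀ xs ys → count P? (xs ++ ys) ≡ count P? xs ℕ.+ count P? ys
  count-++ xs ys = trans (cong length (filter-++ P? xs ys)) (length-++ (filter P? xs))

  count-none : (∀ x → ¬ P x) → ∀ xs → count P? xs ≡ 0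
  count-none ¬P xs = cong length (filter-none P? (universal ¬P xs))

  count-≐ : {Q : Pred A 0ℓ} (Q? : Decidable₁ Q) → P ≐ Q → ∀ xs → count P? xs ≡ count Q? xs
  count-≐ Q? P≐Q xs = cong length (filter-≐ P? Q? P≐Q xs)

  count-map : (f : B → A) → ∀ xs → count P? (map f xs) ≡ count (P? ∘ f) xs
  count-map f [] = refl
  count-map f (x ∷ xs) with P? (f x)
  ... | yes _ = cong suc (count-map f xs)
  ... | no  _ = count-map f xs

-- Subsets of given size and binomial coefficients.

bounded-subset? : (I : Subset n) (k : ℕ) → Decidable₁ (λ F → F ⊆ I × ∣ F ∣ ≡ k)
bounded-subset? I k F = (F ⊆? I) ×-dec (∣ F ∣ ℕ.≟ k)

-- Pascal's rule: the `F` that omit the first element always contribute `∣ I ∣ C k`. Those that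
-- contain it contribute nothing when `s` is `outside`, and when `s` is `inside` they correspond to
-- subsets of `I` with one element fewer.
count-subsets : (I : Subset n) (k : ℕ) → count (bounded-subset? I k) (allSubsets n) ≡ ∣ I ∣ C k
count-subsets []      zero    = refl
count-subsets []      (suc k) = refl
count-subsets {suc n} (s ∷ I) k = begin
  count P? (map (outside ∷_) Fs ++ map (inside ∷_) Fs)
    ≡⟨ count-++ P? (map (outside ∷_) Fs) _ ⟩
  count P? (map (outside ∷_) Fs) ℕ.+ count P? (map (inside ∷_) Fs)
    ≡⟨ cong₂ ℕ._+_ (count-map P? _ Fs) (count-map P? _ Fs) ⟩
  count (P? ∘ (outside ∷_)) Fs ℕ.+ count (P? ∘ (inside ∷_)) Fs
    ≡⟨ cong (ℕ._+ count (P? ∘ (inside ∷_)) Fs)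
         (count-≐ (P? ∘ (outside ∷_)) (bounded-subset? I k)
           (Product.map₁ drop-∷-⊆ , Product.map₁ out⊆) Fs) ⟩
  count (bounded-subset? I k) Fs ℕ.+ count (P? ∘ (inside ∷_)) Fs
    ≡⟨ cong (ℕ._+ count (P? ∘ (inside ∷_)) Fs) (count-subsets I k) ⟩
  ∣ I ∣ C k ℕ.+ count (P? ∘ (inside ∷_)) Fs
    ≡⟨ with-first s k ⟩
  ∣ s ∷ I ∣ C k ∎
  where
  open ≡-Reasoning
  Fs = allSubsets n
  P? = bounded-subset? (s ∷ I) k

  Q? : ∀ s k → Decidable₁ (λ F → inside ∷ F ⊆ s ∷ I × ∣ inside ∷ F ∣ ≡ k)
  Q? s k F = bounded-subset? (s ∷ I) k (inside ∷ F)

  with-first : ∀ s k → ∣ I ∣ C k ℕ.+ count (Q? s k) Fs ≡ ∣ s ∷ I ∣ C k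
  with-first outside k = trans
    (cong (∣ I ∣ C k ℕ.+_)
      (count-none (Q? outside k) (λ F (F⊆I , _) → contradiction (F⊆I here) λ ()) Fs))
    (ℕ.+-identityʳ _)
  -- A set with an element never has size 0, and both `∣ I ∣ C 0 + 0` and `suc ∣ I ∣ C 0` evaluate
  -- to 1.
  with-first inside zero = cong (∣ I ∣ C 0 ℕ.+_) (count-none (Q? inside 0) (λ F ()) Fs)
  with-first inside (suc k) = begin
    ∣ I ∣ C suc k ℕ.+ count (Q? inside (suc k)) Fs
      ≡⟨ cong (∣ I ∣ C suc k ℕ.+_) (count-≐ (Q? inside (suc k)) (bounded-subset? I k)
           (Product.map drop-∷-⊆ ℕ.suc-injective , Product.map in⊆in (cong suc)) Fs) ⟩
    ∣ I ∣ C suc k ℕ.+ count (bounded-subset? I k) Fs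
      ≡⟨ cong (∣ I ∣ C suc k ℕ.+_) (count-subsets I k) ⟩
    ∣ I ∣ C suc k ℕ.+ ∣ I ∣ C k
      ≡⟨ ℕ.+-comm (∣ I ∣ C suc k) _ ⟩
    ∣ I ∣ C k ℕ.+ ∣ I ∣ C suc k
      ≡⟨ nCk+nC[k+1]≡[n+1]C[k+1] ∣ I ∣ k ⟩
    suc ∣ I ∣ C suc k ∎

-- Increasing enumerations of a subset.

record Enumeration (p : Subset n) (k : ℕ) : Set where
  field
    element    : Fin k → Fin n
    element∈   : ∀ i → element i ∈ p
    increasing : ∀ {i j} → i < j → element i < element j
    index      : ∀ {x} → x ∈ p → ∃ λ i → element i ≡ x

  element-injective : Injective _≡_ _≡_ element
  element-injective {i} {j} eq with <-cmp i j
  ... | tri< i<j _ _ = contradiction eq (<⇒≢ (increasing i<j))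
  ... | tri≈ _ i≡j _ = i≡j
  ... | tri> _ _ i>j = contradiction (sym eq) (<⇒≢ (increasing i>j))

  -- Edges are stored with the smaller end first; this turns that order on vertices into an order on
  -- positions.
  element-cancel-< : ∀ {i j} → element i < element j → i < j
  element-cancel-< {i} {j} lt with <-cmp i j
  ... | tri< i<j _ _ = i<j
  ... | tri≈ _ refl _ = contradiction lt (<-irrefl refl)
  ... | tri> _ _ i>j = contradiction lt (<-asym (increasing i>j))

open Enumeration

enumerate : (p : Subset n) → Enumeration p ∣ p ∣
enumerate [] = record
  { element = λ () ; element∈ = λ () ; increasing = λ {} ; index = λ () }
enumerate (outside ∷ p) = record
  { element    = suc ∘ element E
  ; element∈   = there ∘ element∈ E
  ; increasing = s≤s ∘ increasing E
  ; index      = λ { (there x∈p) → Product.map₂ (cong suc) (index E x∈p) }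
  }
  where E = enumerate p
enumerate (inside ∷ p) = record
  { element    = λ { zero → zero ; (suc i) → suc (element E i) }
  ; element∈   = λ { zero → here ; (suc i) → there (element∈ E i) }
  ; increasing = λ { {zero} {suc j} _ → s≤s z≤n
                   ; {suc i} {suc j} (s≤s i<j) → s≤s (increasing E i<j) }
  ; index      = λ { here → zero , refl
                   ; (there x∈p) → Product.map suc (cong suc) (index E x∈p) }
  }
  where E = enumerate p

two-elements : (p : Subset n) → 2 ≤ ∣ p ∣ → ∃₂ λ x y → x ∈ p × y ∈ p × x ≢ y
two-elements p = go (enumerate p)
  where
  go : ∀ {k} → Enumeration p k → 2 ≤ k → ∃₂ λ x y → x ∈ p × y ∈ p × x ≢ y
  go E (s≤s (s≤s _)) =
    element E zero , element E (suc zero) , element∈ E _ , element∈ E _ ,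
    λ eq → contradiction (element-injective E eq) λ ()

-- Connectivity on three points.

-- Triangle sides, numbered by the opposite vertex.
side : Fin 3 → Fin 3 × Fin 3
side zero             = suc zero , suc (suc zero)
side (suc zero)       = zero , suc (suc zero)
side (suc (suc zero)) = zero , suc zero

ordered-pair-is-side : ∀ {i j : Fin 3} → i < j → ∃ λ k → side k ≡ (i , j)
ordered-pair-is-side {zero}     {suc zero}       _ = suc (suc zero) , refl
ordered-pair-is-side {zero}     {suc (suc zero)} _ = suc zero , refl
ordered-pair-is-side {suc zero} {suc (suc zero)} _ = zero , refl
ordered-pair-is-side {suc zero} {suc zero} (s≤s ())
ordered-pair-is-side {suc (suc zero)} {suc zero} (s≤s ())
ordered-pair-is-side {suc (suc zero)} {suc (suc zero)} (s≤s (s≤s ()))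

module _ {R : Rel (Fin 3) 0ℓ} (R-sym : Symmetric R) where

  private
    -- The sides opposite `k` and `l` meet in the third vertex `h`, which is therefore related to
    -- both others.
    common-vertex : ∀ {k l} → k < l → uncurry R (side k) → uncurry R (side l) →
                    ∃ λ h → ∀ i → Star R h i
    common-vertex {zero} {suc zero} _ p q = suc (suc zero) , λ
      { zero → R-sym q ◅ ε ; (suc zero) → R-sym p ◅ ε ; (suc (suc zero)) → ε }
    common-vertex {zero} {suc (suc zero)} _ p q = suc zero , λ
      { zero → R-sym q ◅ ε ; (suc zero) → ε ; (suc (suc zero)) → p ◅ ε }
    common-vertex {suc zero} {suc (suc zero)} _ p q = zero , λ
      { zero → ε ; (suc zero) → q ◅ ε ; (suc (suc zero)) → p ◅ ε }
    common-vertex {suc zero} {suc zero} (s≤s ())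
    common-vertex {suc (suc zero)} {suc zero} (s≤s ())
    common-vertex {suc (suc zero)} {suc (suc zero)} (s≤s (s≤s ()))

    via-hub : (∃ λ h → ∀ i → Star R h i) → ∀ i j → Star R i j
    via-hub (h , spoke) i j = reverse R-sym (spoke i) ◅◅ spoke j

  two-sides-connect : ∀ {k l} → k ≢ l → uncurry R (side k) → uncurry R (side l) →
                      ∀ i j → Star R i j
  two-sides-connect {k} {l} k≢l p q with <-cmp k l
  ... | tri< k<l _ _ = via-hub (common-vertex k<l p q)
  ... | tri≈ _ k≡l _ = contradiction k≡l k≢l
  ... | tri> _ _ k>l = via-hub (common-vertex k>l q p)

-- Edges, their ends, and induced edge sets.

module _ (G : SimpleGraph n) where
  open SimpleGraph G

  edge-injective : Injective _≡_ _≡_ (lookup edges)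
  edge-injective = lookup-injective
    (filter⁺ _ (cartesianProduct⁺ (allFin⁺ n) (allFin⁺ n)))

  src<tgt : ∀ e → src e < tgt e
  src<tgt e = proj₁ (proj₂ (∈-filter⁻
    (uncurry λ u v → u <? v ×-dec adj? u v)
    {xs = cartesianProduct (allFin n) (allFin n)} (∈-lookup e)))

  joined-symmetric : ∀ H → Symmetric (Joined G H)
  joined-symmetric H = Product.map₂ (Product.map₂ swap)

  -- Labelling ends by `Fin 2` lets `combine` code a pair of edge and end as a single number.
  end : Edge → Fin 2 → Fin n
  end e zero       = src e
  end e (suc zero) = tgt e

  -- A walk between distinct vertices has a first step, and the direction in which that step uses
  -- its edge decides `b`.
  incident-edge : ∀ {W F u v} → u ≢ v → Star (Joined G (W , F)) u v →
                  ∃₂ λ e b → e ∈ F × end e b ≡ u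
  incident-edge u≢v ε = contradiction refl u≢v
  incident-edge u≢v ((e , e∈F , inj₁ eq) ◅ _) = e , zero , e∈F , cong proj₁ eq
  incident-edge u≢v ((e , e∈F , inj₂ eq) ◅ _) = e , suc zero , e∈F , cong proj₂ eq

  inducedEdges : Subset n → Subset (length edges)
  inducedEdges W = proj₂ (induced G W)

  ∈-inducedEdges⁺ : ∀ {W e} → src e ∈ W × tgt e ∈ W → e ∈ inducedEdges W
  ∈-inducedEdges⁺ {W} {e} within = lookup⇒[]= e _
    (trans (lookup∘tabulate _ e) (dec-true ((src e ∈? W) ×-dec (tgt e ∈? W)) within))

  ∈-inducedEdges⁻ : ∀ {W e} → e ∈ inducedEdges W → src e ∈ W × tgt e ∈ W
  ∈-inducedEdges⁻ {W} {e} e∈I = toWitness {a? = within?} (Equivalence.from T-≡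
    -- `induced` tabulates `does`, whereas `toWitness` is stated with `isYes`.
    (trans (isYes≗does within?) (trans (sym (lookup∘tabulate _ e)) ([]=⇒lookup e∈I))))
    where within? = (src e ∈? W) ×-dec (tgt e ∈? W)

  subgraph⇒⊆ : ∀ {W F} → IsSubgraph G (W , F) → F ⊆ inducedEdges W
  subgraph⇒⊆ sub {e} e∈F = ∈-inducedEdges⁺ (sub e e∈F)

  ⊆⇒subgraph : ∀ {W F} → F ⊆ inducedEdges W → IsSubgraph G (W , F)
  ⊆⇒subgraph F⊆I e e∈F = ∈-inducedEdges⁻ (F⊆I e∈F)

  -- Subgraphs on a fixed set of three vertices.

  module _ {W : Subset n} (∣W∣≡3 : ∣ W ∣ ≡ 3) where
    private
      -- The length is an index of `Enumeration`, so it can be made the literal 3 and positions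
      -- become vertices of the model triangle.
      E = subst (Enumeration W) ∣W∣≡3 (enumerate W)

    ends : Fin 3 → Fin n × Fin n
    ends = Product.map (element E) (element E) ∘ side

    -- If the ends have positions `i` and `j`, then `src e < tgt e` forces `i < j`, and every
    -- increasing pair in `Fin 3` is a side, with the same orientation as the stored edge.
    edge-is-side : ∀ e → src e ∈ W × tgt e ∈ W → ∃ λ k → lookup edges e ≡ ends k
    edge-is-side e (src∈ , tgt∈) with index E src∈ | index E tgt∈
    ... | i , i≡ | j , j≡
      with k , eq ← ordered-pair-is-side
             (element-cancel-< E (subst₂ _<_ (sym i≡) (sym j≡) (src<tgt e)))
      = k , trans (cong₂ _,_ (sym i≡) (sym j≡))
                  (cong (Product.map (element E) (element E)) (sym eq))

    -- Since `edges` has no repetitions, the map from edges inside `W` to sides is injective.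
    same-side : ∀ {e e′ k l} → lookup edges e ≡ ends k → lookup edges e′ ≡ ends l →
                k ≡ l → e ≡ e′
    same-side e≡ e′≡ refl = edge-injective (trans e≡ (sym e′≡))

    ∣inducedEdges∣≤3 : ∣ inducedEdges W ∣ ≤ 3
    ∣inducedEdges∣≤3 = injective⇒≤ {f = proj₁ ∘ sideOf}
      (λ {i} {j} eq → element-injective I (same-side (proj₂ (sideOf i)) (proj₂ (sideOf j)) eq))
      where
      I = enumerate (inducedEdges W)
      sideOf = λ i → edge-is-side (element I i) (∈-inducedEdges⁻ (element∈ I i))

    -- Pigeonhole: each vertex of `W` is sent to an edge of `F` together with the end at which it
    -- lies. This is an injection of `Fin 3` into `Fin (∣ F ∣ * 2)`, so `3 ≤ ∣ F ∣ * 2`.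
    connected⇒2≤size : ∀ {F} → Connected G (W , F) → 2 ≤ ∣ F ∣
    connected⇒2≤size {F} (_ , conn) = half (injective⇒≤ {f = code} code-injective)
      where
      EF = enumerate F

      other : ∀ (i : Fin 3) → ∃ (i ≢_)
      other zero    = suc zero , λ ()
      other (suc _) = zero , λ ()

      edgeAt : ∀ i → ∃₂ λ e b → e ∈ F × end e b ≡ element E i
      edgeAt i with j , i≢j ← other i = incident-edge {W} (i≢j ∘ element-injective E)
        (conn _ (element∈ E i) _ (element∈ E j))

      code : Fin 3 → Fin (∣ F ∣ ℕ.* 2)
      code i with e , b , e∈F , _ ← edgeAt i = combine (proj₁ (index EF e∈F)) b

      code-injective : Injective _≡_ _≡_ code
      code-injective {i} {j} eq with edgeAt i | edgeAt j
      ... | e , b , e∈F , eq-i | e′ , b′ , e′∈F , eq-j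
        with k , k≡ ← index EF e∈F | l , l≡ ← index EF e′∈F
        -- Equal codes give the same edge and the same end label, and an end of an edge is a single
        -- vertex.
        with refl , refl ← combine-injective k b l b′ eq
        = element-injective E (trans (sym eq-i)
            (trans (cong (flip end b) (trans (sym k≡) l≡)) eq-j))

      half : ∀ {m} → 3 ≤ m ℕ.* 2 → 2 ≤ m
      half {suc zero} (s≤s (s≤s ()))
      half {suc (suc m)} _ = s≤s (s≤s z≤n)

    -- Distinct edges of `F` occupy distinct sides, so `two-sides-connect` links all positions under
    -- the pulled-back relation `R`; `gmap` carries these walks to `W`.
    2≤size⇒connected : ∀ {F} → IsSubgraph G (W , F) → 2 ≤ ∣ F ∣ → Connected G (W , F)
    2≤size⇒connected {F} sub 2≤∣F∣
      with e , e′ , e∈F , e′∈F , e≢e′ ← two-elements F 2≤∣F∣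
      with k , e≡ ← edge-is-side e (sub e e∈F) | l , e′≡ ← edge-is-side e′ (sub e′ e′∈F)
      = (_ , element∈ E zero) , λ u u∈W v v∈W → walk (index E u∈W) (index E v∈W)
      where
      R : Rel (Fin 3) 0ℓ
      R i j = Joined G (W , F) (element E i) (element E j)

      walk : ∀ {u v} → (∃ λ i → element E i ≡ u) → (∃ λ j → element E j ≡ v) →
             Star (Joined G (W , F)) u v
      walk (i , refl) (j , refl) = gmap (element E) id
        (two-sides-connect {R = R} (joined-symmetric (W , F)) {k} {l} (e≢e′ ∘ same-side e≡ e′≡)
          (e , e∈F , inj₁ e≡) (e′ , e′∈F , inj₁ e′≡) i j)

  -- Summation over vertex sets.

  k₃? : Decidable₁ (λ W → ∣ W ∣ ≡ 3 × Connected G (induced G W))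
  k₃? W = (∣ W ∣ ℕ.≟ 3) ×-dec connected? G (induced G W)

  -- Like `k₃?`, this repeats the test from the definitions verbatim, so that `k₃ G` and `S G i j`
  -- are instances of `count` by definition.
  S? : ∀ i j → Decidable₁ (λ H → IsSubgraph G H × Connected G H × order G H ≡ i × size G H ≡ j)
  S? i j H = isSubgraph? G H ×-dec connected? G H
             ×-dec (order G H ℕ.≟ i) ×-dec (size G H ℕ.≟ j)

  private
    Fs = allSubsets (length edges)

  S[_] : Subset n → ℕ → ℕ → ℕ
  S[ W ] i j = count (λ F → S? i j (W , F)) Fs

  -- Once `2 ≤ j`, connectivity is automatic for edge sets inside `W`, which leaves only a free
  -- choice of `j` induced edges.
  S[]-binomial : ∀ {W} → ∣ W ∣ ≡ 3 → ∀ j → 2 ≤ j → S[ W ] 3 j ≡ ∣ inducedEdges W ∣ C j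
  S[]-binomial {W} ∣W∣≡3 j 2≤j = trans
    (count-≐ (λ F → S? 3 j (W , F)) (bounded-subset? (inducedEdges W) j) (to , from) Fs)
    (count-subsets (inducedEdges W) j)
    where
    to : ∀ {F} → IsSubgraph G (W , F) × Connected G (W , F) × ∣ W ∣ ≡ 3 × ∣ F ∣ ≡ j →
         F ⊆ inducedEdges W × ∣ F ∣ ≡ j
    to (sub , _ , _ , ∣F∣≡j) = subgraph⇒⊆ sub , ∣F∣≡j
    from : ∀ {F} → F ⊆ inducedEdges W × ∣ F ∣ ≡ j →
           IsSubgraph G (W , F) × Connected G (W , F) × ∣ W ∣ ≡ 3 × ∣ F ∣ ≡ j
    from (F⊆I , refl) = sub , 2≤size⇒connected ∣W∣≡3 sub 2≤j , ∣W∣≡3 , refl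
      where sub = ⊆⇒subgraph F⊆I

  -- The count over `W ∷ []` is the indicator of `W` in `k₃`. All terms vanish unless `∣ W ∣ ≡ 3`,
  -- and then the claim is a check of the possible values of `∣ I ∣`.
  identity-at : ∀ W → count k₃? (W ∷ []) ℕ.+ 2 ℕ.* S[ W ] 3 3 ≡ S[ W ] 3 2
  identity-at W = by-order (∣ W ∣ ℕ.≟ 3)
    where
    open ≡-Reasoning
    I = inducedEdges W

    disconnected : ¬ (∣ W ∣ ≡ 3 × Connected G (induced G W)) → count k₃? (W ∷ []) ≡ 0
    disconnected ¬conn = cong length (filter-reject k₃? {xs = []} ¬conn)

    none : ∣ W ∣ ≢ 3 → ∀ j → S[ W ] 3 j ≡ 0
    none ∣W∣≢3 j = count-none (λ F → S? 3 j (W , F))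
      (λ F (_ , _ , ∣W∣≡3 , _) → ∣W∣≢3 ∣W∣≡3) Fs

    few : ∣ W ∣ ≡ 3 → ∣ I ∣ ≤ 1 → count k₃? (W ∷ []) ≡ 0
    few ∣W∣≡3 ∣I∣≤1 = disconnected
      (λ (_ , conn) → ℕ.<⇒≱ (connected⇒2≤size ∣W∣≡3 conn) ∣I∣≤1)

    many : ∣ W ∣ ≡ 3 → 2 ≤ ∣ I ∣ → count k₃? (W ∷ []) ≡ 1
    many ∣W∣≡3 2≤∣I∣ = cong length (filter-accept k₃? {xs = []}
      (∣W∣≡3 , 2≤size⇒connected ∣W∣≡3 (⊆⇒subgraph id) 2≤∣I∣))

    at-size : ∣ W ∣ ≡ 3 → ∀ i → i ≤ 3 → ∣ I ∣ ≡ i →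
              count k₃? (W ∷ []) ℕ.+ 2 ℕ.* (i C 3) ≡ i C 2
    -- The constants added are the values of `2 * (i C 3)`; the four cases read 0 + 0 = 0, 0 + 0 =
    -- 0, 1 + 0 = 1 and 1 + 2 = 3.
    at-size ∣W∣≡3 0 _ eq = cong (ℕ._+ 0) (few ∣W∣≡3 (ℕ.≤-trans (ℕ.≤-reflexive eq) z≤n))
    at-size ∣W∣≡3 1 _ eq = cong (ℕ._+ 0) (few ∣W∣≡3 (ℕ.≤-reflexive eq))
    at-size ∣W∣≡3 2 _ eq = cong (ℕ._+ 0) (many ∣W∣≡3 (ℕ.≤-reflexive (sym eq)))
    at-size ∣W∣≡3 3 _ eq = cong (ℕ._+ 2)
      (many ∣W∣≡3 (ℕ.≤-trans (ℕ.n≤1+n 2) (ℕ.≤-reflexive (sym eq))))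
    at-size _ (suc (suc (suc (suc _)))) (s≤s (s≤s (s≤s ()))) _

    by-order : Dec (∣ W ∣ ≡ 3) → count k₃? (W ∷ []) ℕ.+ 2 ℕ.* S[ W ] 3 3 ≡ S[ W ] 3 2
    by-order (no ∣W∣≢3) = begin
      count k₃? (W ∷ []) ℕ.+ 2 ℕ.* S[ W ] 3 3
        ≡⟨ cong₂ (λ a b → a ℕ.+ 2 ℕ.* b) (disconnected (∣W∣≢3 ∘ proj₁)) (none ∣W∣≢3 3) ⟩
      0
        ≡⟨ none ∣W∣≢3 2 ⟨
      S[ W ] 3 2 ∎
    by-order (yes ∣W∣≡3) = begin
      count k₃? (W ∷ []) ℕ.+ 2 ℕ.* S[ W ] 3 3
        ≡⟨ cong (λ s → count k₃? (W ∷ []) ℕ.+ 2 ℕ.* s) (S[]-binomial ∣W∣≡3 3 (ℕ.n≤1+n 2)) ⟩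
      count k₃? (W ∷ []) ℕ.+ 2 ℕ.* (∣ I ∣ C 3)
        ≡⟨ at-size ∣W∣≡3 _ (∣inducedEdges∣≤3 ∣W∣≡3) refl ⟩
      ∣ I ∣ C 2
        ≡⟨ S[]-binomial ∣W∣≡3 2 ℕ.≤-refl ⟨
      S[ W ] 3 2 ∎

  S-∷ : ∀ i j W Ws → count (S? i j) (cartesianProduct (W ∷ Ws) Fs)
                     ≡ S[ W ] i j ℕ.+ count (S? i j) (cartesianProduct Ws Fs)
  S-∷ i j W Ws = trans (count-++ (S? i j) (map (W ,_) Fs) _)
                       (cong (ℕ._+ _) (count-map (S? i j) (W ,_) Fs))

  -- Stated for arbitrary lists so that induction applies: each vertex set contributes its own
  -- instance of `identity-at`.
  identity-over : ∀ Ws → count k₃? Ws ℕ.+ 2 ℕ.* count (S? 3 3) (cartesianProduct Ws Fs)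
                         ≡ count (S? 3 2) (cartesianProduct Ws Fs)
  identity-over [] = refl
  identity-over (W ∷ Ws) = begin
    count k₃? (W ∷ Ws) ℕ.+ 2 ℕ.* count (S? 3 3) (cartesianProduct (W ∷ Ws) Fs)
      ≡⟨ cong₂ (λ a b → a ℕ.+ 2 ℕ.* b) (count-++ k₃? (W ∷ []) Ws) (S-∷ 3 3 W Ws) ⟩
    (k ℕ.+ ks) ℕ.+ 2 ℕ.* (s ℕ.+ ss)
      ≡⟨ rearrange k ks s ss ⟩
    (k ℕ.+ 2 ℕ.* s) ℕ.+ (ks ℕ.+ 2 ℕ.* ss)
      ≡⟨ cong₂ ℕ._+_ (identity-at W) (identity-over Ws) ⟩
    S[ W ] 3 2 ℕ.+ count (S? 3 2) (cartesianProduct Ws Fs)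
      ≡⟨ S-∷ 3 2 W Ws ⟨
    count (S? 3 2) (cartesianProduct (W ∷ Ws) Fs) ∎
    where
    open ≡-Reasoning
    k  = count k₃? (W ∷ [])
    ks = count k₃? Ws
    s  = S[ W ] 3 3
    ss = count (S? 3 3) (cartesianProduct Ws Fs)
    rearrange : ∀ k ks s ss → (k ℕ.+ ks) ℕ.+ 2 ℕ.* (s ℕ.+ ss)
                              ≡ (k ℕ.+ 2 ℕ.* s) ℕ.+ (ks ℕ.+ 2 ℕ.* ss)
    rearrange = solve-∀

  -- The additive form stays within the natural numbers and avoids truncated subtraction.
  k₃+2S₃₃≡S₃₂ : k₃ G ℕ.+ 2 ℕ.* S G 3 3 ≡ S G 3 2
  k₃+2S₃₃≡S₃₂ = identity-over (allSubsets n)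

lemma27 : ∀ (n : ℕ) (G : SimpleGraph n) → + (k₃ G) ≡ + (S G 3 2) - (+ 2) * + (S G 3 3)
lemma27 n G = begin
  + k₃ G
    -- Adds and subtracts `2 * S G 3 3`, so that the additive identity can be substituted.
    ≡⟨ //-rightDividesʳ (AbelianGroup.group ℤ.+-0-abelianGroup) (+ (2 ℕ.* S G 3 3)) (+ k₃ G) ⟨
  + (k₃ G ℕ.+ 2 ℕ.* S G 3 3) - + (2 ℕ.* S G 3 3)
    ≡⟨ cong₂ (λ a b → + a - b) (k₃+2S₃₃≡S₃₂ G) (ℤ.pos-* 2 (S G 3 3)) ⟩
  + S G 3 2 - + 2 * + S G 3 3 ∎
  where open ≡-Reasoning
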